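{- Let $k$ be odd and let $\phi$ be a monotone $[k]$-edge-labeling of $K^{(2)}_n$ that minimizes the number of bad triples among all monotone $[k]$-edge-labelings of $K^{(2)}_n$. Then the number of bad triples of $\phi$ is at least $(1-o(1))\frac{4}{(k+1)^2}\binom{n}{3}$, where $o(1)\to0$ as $n\to\infty$ with $k$ fixed.
   Context: $K^{(2)}_n$ is the complete graph on $[n]$ with its natural order. A $[k]$-edge-labeling $\phi$ assigns to each pair $uv$ ($u<v$) a label $\phi(uv)\in\{1,\dots,k\}$; it is monotone if $\phi(uv)\le\phi(vw)$ whenever $u<v<w$. A triple $u<v<w$ is good if $\phi(uv)<\phi(vw)$ and bad otherwise. -}

module Defs where

open import Data.Fin using (Fin; _<_; _≤_)
open import Data.Fin.Properties using (_<?_)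
open import Data.Integer using (+_)
open import Data.List using (List; allFin; cartesianProduct; filter; length)
open import Data.Nat as ℕ using (ℕ)
open import Data.Product using (Σ-syntax; ∃-syntax; _×_; _,_)
open import Data.Rational as ℚ using (ℚ; 0ℚ)
open import Relation.Nullary using (¬_; Dec; yes; no)
open import Relation.Nullary.Decidable using (¬?)

-- [n] is Fin n and the label set {1,…,k} is Fin k, each with its natural order.
-- Only the pairs u < v carry a label; irrelevance of the proof of u < v makes
-- the label depend on the pair alone.
Labeling : ℕ → ℕ → Set
Labeling k n = (u v : Fin n) → .(u < v) → Fin k

module _ {k n : ℕ} (φ : Labeling k n) where

  Monotone : Set
  Monotone = ∀ u v w (u<v : u < v) (v<w : v < w) → φ u v u<v ≤ φ v w v<w

  Good : (u v w : Fin n) → u < v → v < w → Set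
  Good u v w u<v v<w = φ u v u<v < φ v w v<w

  Bad : Fin n × Fin n × Fin n → Set
  Bad (u , v , w) = Σ[ u<v ∈ u < v ] Σ[ v<w ∈ v < w ] ¬ Good u v w u<v v<w

  bad? : ∀ t → Dec (Bad t)
  bad? (u , v , w) with u <? v | v <? w
  ... | no u≮v  | _       = no λ (u<v , _) → u≮v u<v
  ... | yes _   | no v≮w  = no λ (_ , v<w , _) → v≮w v<w
  ... | yes u<v | yes v<w with ¬? (φ u v u<v <? φ v w v<w)
  ...   | yes ¬good  = yes (u<v , v<w , ¬good)
  ...   | no  ¬¬good = no λ (_ , _ , ¬good) → ¬¬good ¬good

allTriples : ∀ n → List (Fin n × Fin n × Fin n)
allTriples n = cartesianProduct (allFin n) (cartesianProduct (allFin n) (allFin n))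

badCount : ∀ {k n} → Labeling k n → ℕ
badCount {n = n} φ = length (filter (bad? φ) (allTriples n))

MinimizesBad : ∀ {k n} → Labeling k n → Set
MinimizesBad {k} {n} φ =
  Monotone φ × ((ψ : Labeling k n) → Monotone ψ → badCount φ ℕ.≤ badCount ψ)

TendsToZero : (ℕ → ℚ) → Set
TendsToZero o =
  (ε : ℚ) → 0ℚ ℚ.< ε → ∃[ N ] ((n : ℕ) → N ℕ.≤ n → ℚ.∣ o n ∣ ℚ.< ε)

fromℕ : ℕ → ℚ
fromℕ m = + m ℚ./ 1

{-# OPTIONS --safe #-}

-- Give each vertex v a threshold c(v) with in-labels ≤ c(v) ≤ out-labels.  Then c is weakly increasing
-- and, with L(v) and R(v) the numbers of in- and out-edges at v labelled c(v), at least L(v) R(v) bad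
-- triples have middle vertex v.
--
-- For each of the k + 1 gaps between consecutive classes of c (the outer two included), let the area be
-- the sum of L over the class below plus the sum of R over the class above.  A vertex at which the largest
-- of these L's and R's is attained lies in at least (area) - n bad triples.  By minimality all vertices
-- lie in the same number of bad triples up to O(n): otherwise delete a vertex lying in many and double
-- one lying in few.  So the number T of bad triples satisfies 3T ≥ n · area - O(n²) for every gap.
--
-- An edge within a class contributes 2 to the sum of all areas and an edge between consecutive classes
-- contributes at least 1, so that sum is at least half the sum of the squares of the sizes of the unions of
-- two consecutive classes, up to O(n).  These sizes add up to 2n, and by Cauchy-Schwarz the areas add
-- up to at least 2n²/(k+1) - O(n), whence T ≥ 4/(k+1)² · n³/6 - O(n²).
module Submission where

open import Data.Bool using (if_then_else_)
open import Data.Fin as F using (Fin; zero; suc; toℕ; inject₁; punchIn; punchOut; pinch)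
open import Data.Fin.Properties as Finₚ using (_<?_; _≟_; toℕ-injective; toℕ-inject₁; punchIn-punchOut; punchInᵢ≢i)
import Data.Integer as ℤ
import Data.Integer.Properties as ℤₚ
open import Data.Integer.Tactic.RingSolver using () renaming (solve-∀ to solveℤ-∀)
open import Data.List using (List; []; _∷_; _++_; map; filter; length; tabulate; allFin; cartesianProduct)
open import Data.List.Properties using (filter-++; length-++)
open import Data.Nat using (ℕ; zero; suc; _+_; _*_; _^_; _%_; _≤_; z≤n; s≤s)
open import Data.Nat.Combinatorics using (_C_; nC1≡n; nCk+nC[k+1]≡[n+1]C[k+1])
open import Data.Nat.Properties hiding (_≟_; _<?_)
open import Data.Nat.Tactic.RingSolver using (solve-∀)
open import Data.Product using (Σ-syntax; ∃-syntax; _×_; _,_; proj₁; proj₂)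
open import Data.Rational as ℚ using (1ℚ; mkℚ; _/_; _-_; toℚᵘ)
import Data.Rational.Properties as ℚₚ
open import Data.Rational.Unnormalised as ℚᵘ using (mkℚᵘ; *≤*; *<*)
import Data.Rational.Unnormalised.Properties as ℚᵘₚ
open import Data.Sum using (_⊎_; inj₁; inj₂)
open import Function using (_∘_)
open import Relation.Binary using (tri<; tri≈; tri>)
open import Relation.Binary.PropositionalEquality
open import Relation.Nullary using (Dec; yes; no; does; ¬_; contradiction; _×-dec_)
open import Relation.Unary using (Decidable)
open import Algebra.Properties.Semiring.Sum +-*-semiring using (sum; sum-syntax; sum-cong-≗; sum-remove; ∑-distrib-+; ∑-comm; *-distribˡ-sum; *-distribʳ-sum)
open import Defs

-- Finite sums and indicators

∑-mono-≤ : ∀ {n} {f g : Fin n → ℕ} → (∀ i → f i ≤ g i) → sum f ≤ sum g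
∑-mono-≤ {zero}  f≤g = z≤n
∑-mono-≤ {suc n} f≤g = +-mono-≤ (f≤g zero) (∑-mono-≤ (f≤g ∘ suc))

∑-const : ∀ n c → ∑[ i < n ] c ≡ n * c
∑-const zero    c = refl
∑-const (suc n) c = cong (c +_) (∑-const n c)

∑-bounded : ∀ {n} {f : Fin n → ℕ} c → (∀ i → f i ≤ c) → sum f ≤ n * c
∑-bounded {n} c f≤c = ≤-trans (∑-mono-≤ f≤c) (≤-reflexive (∑-const n c))

∑-distrib-+₃ : ∀ {n} (f g h : Fin n → ℕ) → ∑[ i < n ] (f i + g i + h i) ≡ sum f + sum g + sum h
∑-distrib-+₃ f g h = trans (∑-distrib-+ (λ i → f i + g i) h) (cong (_+ sum h) (∑-distrib-+ f g))

2ab≤a²+b² : ∀ a b → 2 * (a * b) ≤ a * a + b * b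
2ab≤a²+b² a b with ≤-total a b
... | inj₁ a≤b with d , refl ← m≤n⇒∃[o]m+o≡n a≤b = ≤-trans (m≤m+n _ (d * d)) (≤-reflexive (square a d))
  where
  square : ∀ a d → 2 * (a * (a + d)) + d * d ≡ a * a + (a + d) * (a + d)
  square = solve-∀
... | inj₂ b≤a with d , refl ← m≤n⇒∃[o]m+o≡n b≤a = ≤-trans (m≤m+n _ (d * d)) (≤-reflexive (square b d))
  where
  square : ∀ b d → 2 * ((b + d) * b) + d * d ≡ (b + d) * (b + d) + b * b
  square = solve-∀

-- Summing `2ab≤a²+b²` with `a = suc n * f i` and `b = s` over `i` puts two copies of
-- `suc n * (s * s)` on the left and one on the right. Cancelling one copy and a factor `suc n`
-- leaves the claim, without any subtraction in `ℕ`.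
∑-Cauchy-Schwarz : ∀ {n} (f : Fin (suc n) → ℕ) → sum f * sum f ≤ suc n * ∑[ i < suc n ] (f i * f i)
∑-Cauchy-Schwarz {n} f = *-cancelˡ-≤ (suc n) (+-cancelʳ-≤ (suc n * (s * s)) _ _ (begin
  suc n * (s * s) + suc n * (s * s)               ≡⟨ twice (suc n) s ⟩
  2 * suc n * s * s                               ≡⟨ *-distribˡ-sum (2 * suc n * s) f ⟩
  ∑[ i < suc n ] (2 * suc n * s * f i)            ≤⟨ ∑-mono-≤ (λ i → ≤-trans (≤-reflexive (regroup (suc n) s (f i))) (2ab≤a²+b² (suc n * f i) s)) ⟩
  ∑[ i < suc n ] (suc n * f i * (suc n * f i) + s * s)  ≡⟨ ∑-distrib-+ (λ i → suc n * f i * (suc n * f i)) (λ _ → s * s) ⟩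
  ∑[ i < suc n ] (suc n * f i * (suc n * f i)) + ∑[ i < suc n ] (s * s)
    ≡⟨ cong₂ _+_ (trans (sum-cong-≗ (λ i → collect (suc n) (f i))) (sym (*-distribˡ-sum (suc n * suc n) (λ i → f i * f i)))) (∑-const (suc n) (s * s)) ⟩
  suc n * suc n * q + suc n * (s * s)             ≡⟨ cong (_+ suc n * (s * s)) (*-assoc (suc n) (suc n) q) ⟩
  suc n * (suc n * q) + suc n * (s * s)           ∎))
  where
  open ≤-Reasoning
  s = sum f
  q = ∑[ i < suc n ] (f i * f i)
  twice : ∀ m s → m * (s * s) + m * (s * s) ≡ 2 * m * s * s
  twice = solve-∀
  regroup : ∀ m s x → 2 * m * s * x ≡ 2 * (m * x * s)
  regroup = solve-∀
  collect : ∀ m x → m * x * (m * x) ≡ m * m * (x * x)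
  collect = solve-∀

argmax : ∀ {n} (f : Fin (suc n) → ℕ) → ∃[ v ] (∀ u → f u ≤ f v)
argmax {zero}  f = zero , λ { zero → ≤-refl }
argmax {suc n} f with v , max ← argmax (f ∘ suc) | ≤-total (f zero) (f (suc v))
... | inj₁ f0≤fv = suc v , λ { zero → f0≤fv ; (suc u) → max u }
... | inj₂ fv≤f0 = zero  , λ { zero → ≤-refl ; (suc u) → ≤-trans (max u) fv≤f0 }

𝟙 : ∀ {p} {P : Set p} → Dec P → ℕ
𝟙 P? = if does P? then 1 else 0

module _ {p} {P : Set p} where

  𝟙-yes : (P? : Dec P) → P → 𝟙 P? ≡ 1
  𝟙-yes (yes _) _ = refl
  𝟙-yes (no ¬p) p = contradiction p ¬p

  𝟙-no : (P? : Dec P) → ¬ P → 𝟙 P? ≡ 0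
  𝟙-no (yes p) ¬p = contradiction p ¬p
  𝟙-no (no _)  _  = refl

  𝟙-least : ∀ {m} (P? : Dec P) → (P → 1 ≤ m) → 𝟙 P? ≤ m
  𝟙-least (yes p) p⇒1≤m = p⇒1≤m p
  𝟙-least (no _)  _     = z≤n

  𝟙≤1 : (P? : Dec P) → 𝟙 P? ≤ 1
  𝟙≤1 P? = 𝟙-least P? (λ _ → ≤-refl)

δ : ∀ {n} → Fin n → Fin n → ℕ
δ i j = 𝟙 (i Finₚ.≟ j)

δ-refl : ∀ {n} (i : Fin n) → δ i i ≡ 1
δ-refl i = 𝟙-yes (i Finₚ.≟ i) refl

δ-≢ : ∀ {n} {i j : Fin n} → i ≢ j → δ i j ≡ 0
δ-≢ {i = i} {j} = 𝟙-no (i Finₚ.≟ j)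

∑-δˡ : ∀ {n} (j : Fin n) (f : Fin n → ℕ) → ∑[ i < n ] (δ i j * f i) ≡ f j
∑-δˡ {suc n} zero    f = trans (cong₂ _+_ (+-identityʳ (f zero)) (trans (∑-const n 0) (*-zeroʳ n))) (+-identityʳ (f zero))
∑-δˡ {suc n} (suc j) f = ∑-δˡ j (f ∘ suc)

∑-δ : ∀ {n} (j : Fin n) → ∑[ i < n ] δ i j ≡ 1
∑-δ {n} j = trans (sum-cong-≗ (λ i → sym (*-identityʳ (δ i j)))) (∑-δˡ j (λ _ → 1))

-- Lengths of filtered lists as sums of indicators

module _ {a p} {A : Set a} {P : A → Set p} (P? : Decidable P) where

  length-filter-∷ : ∀ x xs → length (filter P? (x ∷ xs)) ≡ 𝟙 (P? x) + length (filter P? xs)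
  length-filter-∷ x xs with P? x
  ... | yes _ = refl
  ... | no  _ = refl

  length-filter-tabulate : ∀ {n} (f : Fin n → A) → length (filter P? (tabulate f)) ≡ ∑[ i < n ] 𝟙 (P? (f i))
  length-filter-tabulate {zero}  f = refl
  length-filter-tabulate {suc n} f = trans (length-filter-∷ (f zero) _) (cong (𝟙 (P? (f zero)) +_) (length-filter-tabulate (f ∘ suc)))

  length-filter-map : ∀ {b} {B : Set b} (f : B → A) xs → length (filter P? (map f xs)) ≡ length (filter (P? ∘ f) xs)
  length-filter-map f []       = refl
  length-filter-map f (x ∷ xs) with P? (f x)
  ... | yes _ = cong suc (length-filter-map f xs)
  ... | no  _ = length-filter-map f xs

length-filter-cartesianProduct : ∀ {a b p} {A : Set a} {B : Set b} {P : A × B → Set p} (P? : Decidable P)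
  {n} (f : Fin n → A) (ys : List B) →
  length (filter P? (cartesianProduct (tabulate f) ys)) ≡ ∑[ i < n ] length (filter (λ y → P? (f i , y)) ys)
length-filter-cartesianProduct P? {zero}  f ys = refl
length-filter-cartesianProduct P? {suc n} f ys = begin
  length (filter P? (row ++ rest))                     ≡⟨ cong length (filter-++ P? row rest) ⟩
  length (filter P? row ++ filter P? rest)             ≡⟨ length-++ (filter P? row) ⟩
  length (filter P? row) + length (filter P? rest)     ≡⟨ cong₂ _+_ (length-filter-map P? (f zero ,_) ys) (length-filter-cartesianProduct P? (f ∘ suc) ys) ⟩
  _                                                    ∎
  where
  open ≡-Reasoning
  row = map (f zero ,_) ys
  rest = cartesianProduct (tabulate (f ∘ suc)) ys

B : ∀ {k n} → Labeling k n → Fin n → Fin n → Fin n → ℕ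
B φ a b c = 𝟙 (bad? φ (a , b , c))

badCount≡∑B : ∀ {k n} (φ : Labeling k n) → badCount φ ≡ ∑[ a < n ] ∑[ b < n ] ∑[ c < n ] B φ a b c
badCount≡∑B {n = n} φ = trans (length-filter-cartesianProduct (bad? φ) (λ a → a) _)
  (sum-cong-≗ λ a → trans (length-filter-cartesianProduct (λ t → bad? φ (a , t)) (λ b → b) (allFin n))
  (sum-cong-≗ λ b → length-filter-tabulate (λ c → bad? φ (a , b , c)) (λ c → c)))

-- `pinch i` hits `i` twice and every other index once.
∑-pinch : ∀ {m} (i : Fin m) (f : Fin m → ℕ) → ∑[ a < suc m ] f (pinch i a) ≡ sum f + f i
∑-pinch zero    f = +-comm (f zero) _
∑-pinch (suc i) f = trans (cong (f zero +_) (∑-pinch i (f ∘ suc))) (sym (+-assoc (f zero) _ _))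

-- Triple sums and replacing a vertex by a copy of another

∑³ : ∀ {n} → (Fin n → Fin n → Fin n → ℕ) → ℕ
∑³ {n} f = ∑[ a < n ] ∑[ b < n ] ∑[ c < n ] f a b c

∑³-mono-≤ : ∀ {n} {f g : Fin n → Fin n → Fin n → ℕ} → (∀ a b c → f a b c ≤ g a b c) → ∑³ f ≤ ∑³ g
∑³-mono-≤ f≤g = ∑-mono-≤ λ a → ∑-mono-≤ λ b → ∑-mono-≤ λ c → f≤g a b c

∑³-cong : ∀ {n} {f g : Fin n → Fin n → Fin n → ℕ} → (∀ a b c → f a b c ≡ g a b c) → ∑³ f ≡ ∑³ g
∑³-cong f≡g = sum-cong-≗ λ a → sum-cong-≗ λ b → sum-cong-≗ λ c → f≡g a b c

∑³-distrib-+ : ∀ {n} (f g : Fin n → Fin n → Fin n → ℕ) → ∑³ (λ a b c → f a b c + g a b c) ≡ ∑³ f + ∑³ g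
∑³-distrib-+ {n} f g =
  trans (sum-cong-≗ λ a → trans (sum-cong-≗ λ b → ∑-distrib-+ (f a b) (g a b)) (∑-distrib-+ (λ b → sum (f a b)) (λ b → sum (g a b))))
    (∑-distrib-+ (λ a → ∑[ b < n ] sum (f a b)) (λ a → ∑[ b < n ] sum (g a b)))

∑³-distrib-+₃ : ∀ {n} (f g h : Fin n → Fin n → Fin n → ℕ) →
  ∑³ (λ a b c → f a b c + g a b c + h a b c) ≡ ∑³ f + ∑³ g + ∑³ h
∑³-distrib-+₃ f g h = trans (∑³-distrib-+ (λ a b c → f a b c + g a b c) h) (cong (_+ ∑³ h) (∑³-distrib-+ f g))

module _ {n} (F : Fin n → Fin n → Fin n → ℕ) where

  -- When `F` is the indicator of a set of ordered triples with distinct entries, this is the degree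
  -- of `v` in the corresponding 3-uniform hypergraph.
  degree : Fin n → ℕ
  degree v = ∑[ b < n ] ∑[ c < n ] F v b c + ∑[ a < n ] ∑[ c < n ] F a v c + ∑[ a < n ] ∑[ b < n ] F a b v

  -- Handshake count: each triple is counted once for each of its three positions.
  ∑-degree : ∑[ v < n ] degree v ≡ 3 * ∑³ F
  ∑-degree = begin
    ∑[ v < n ] degree v       ≡⟨ ∑-distrib-+₃ (λ v → ∑[ b < n ] sum (F v b)) (λ v → ∑[ a < n ] sum (F a v)) (λ v → ∑[ a < n ] ∑[ b < n ] F a b v) ⟩
    ∑³ F + ∑[ v < n ] ∑[ a < n ] sum (F a v) + ∑[ v < n ] ∑[ a < n ] ∑[ b < n ] F a b v
      ≡⟨ cong₂ (λ s t → ∑³ F + s + t) (∑-comm (λ v a → sum (F a v)))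
           (trans (∑-comm (λ v a → ∑[ b < n ] F a b v)) (sum-cong-≗ λ a → ∑-comm (λ v b → F a b v))) ⟩
    ∑³ F + ∑³ F + ∑³ F        ≡⟨ triple (∑³ F) ⟩
    3 * ∑³ F                  ∎
    where
    open ≡-Reasoning
    triple : ∀ t → t + t + t ≡ 3 * t
    triple = solve-∀

  -- As a single triple sum the degree can be compared term by term with `∑³ F`, which is what
  -- `∑³-π` does.
  degree-δ : ∀ v → degree v ≡ ∑³ (λ a b c → (δ a v + δ b v + δ c v) * F a b c)
  degree-δ v = sym (begin
    ∑³ (λ a b c → (δ a v + δ b v + δ c v) * F a b c)
      ≡⟨ ∑³-cong (λ a b c → expand (δ a v) (δ b v) (δ c v) (F a b c)) ⟩
    ∑³ (λ a b c → δ a v * F a b c + δ b v * F a b c + δ c v * F a b c)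
      ≡⟨ ∑³-distrib-+₃ (λ a b c → δ a v * F a b c) (λ a b c → δ b v * F a b c) (λ a b c → δ c v * F a b c) ⟩
    ∑³ (λ a b c → δ a v * F a b c) + ∑³ (λ a b c → δ b v * F a b c) + ∑³ (λ a b c → δ c v * F a b c)
      ≡⟨ cong₂ _+_ (cong₂ _+_
           (trans (sum-cong-≗ λ a → trans (sum-cong-≗ λ b → sym (*-distribˡ-sum (δ a v) (F a b))) (sym (*-distribˡ-sum (δ a v) (λ b → sum (F a b)))))
             (∑-δˡ v (λ a → ∑[ b < n ] sum (F a b))))
           (sum-cong-≗ λ a → trans (sum-cong-≗ λ b → sym (*-distribˡ-sum (δ b v) (F a b))) (∑-δˡ v (λ b → sum (F a b)))))
           (sum-cong-≗ λ a → sum-cong-≗ λ b → ∑-δˡ v (F a b)) ⟩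
    degree v ∎)
    where
    open ≡-Reasoning
    expand : ∀ x y z f → (x + y + z) * f ≡ x * f + y * f + z * f
    expand = solve-∀

-- π is weakly monotone, misses v and takes the value z twice and all others once.
module Replace {m} (v : Fin (suc m)) (z′ : Fin m) where

  z : Fin (suc m)
  z = punchIn v z′

  π : Fin (suc m) → Fin (suc m)
  π = punchIn v ∘ pinch z′

  π-mono : ∀ {a b} → a F.≤ b → π a F.≤ π b
  π-mono {a} {b} a≤b = Finₚ.punchIn-mono-≤ v (pinch z′ a) (pinch z′ b) (Finₚ.pinch-mono-≤ z′ a≤b)

  ∑-π : ∀ f → ∑[ a < suc m ] f (π a) + f v ≡ sum f + f z
  ∑-π f = begin
    ∑[ a < suc m ] f (π a) + f v             ≡⟨ cong (_+ f v) (∑-pinch z′ (f ∘ punchIn v)) ⟩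
    ∑[ i < m ] f (punchIn v i) + f z + f v   ≡⟨ rotate (∑[ i < m ] f (punchIn v i)) (f z) (f v) ⟩
    f v + ∑[ i < m ] f (punchIn v i) + f z   ≡⟨ cong (_+ f z) (sum-remove {i = v} f) ⟨
    sum f + f z                              ∎
    where
    open ≡-Reasoning
    rotate : ∀ s x y → s + x + y ≡ y + s + x
    rotate = solve-∀

  -- The size of the fibre of `π` over `y`.
  weight : Fin (suc m) → ℕ
  weight y = ∑[ a < suc m ] δ y (π a)

  weight-δ : ∀ y → weight y + δ y v ≡ 1 + δ y z
  weight-δ y = trans (∑-π (δ y)) (cong (_+ δ y z) (trans (sum-cong-≗ (δ-sym y)) (∑-δ y)))
    where
    δ-sym : ∀ {n} (i j : Fin n) → δ i j ≡ δ j i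
    δ-sym i j with i ≟ j
    ... | yes i≡j = sym (𝟙-yes (j ≟ i) (sym i≡j))
    ... | no  i≢j = sym (𝟙-no (j ≟ i) (i≢j ∘ sym))

  ∑-weight : ∀ f → ∑[ a < suc m ] f (π a) ≡ ∑[ y < suc m ] (weight y * f y)
  ∑-weight f = begin
    ∑[ a < suc m ] f (π a)                             ≡⟨ sum-cong-≗ (λ a → ∑-δˡ (π a) f) ⟨
    ∑[ a < suc m ] ∑[ y < suc m ] (δ y (π a) * f y)    ≡⟨ ∑-comm (λ a y → δ y (π a) * f y) ⟩
    ∑[ y < suc m ] ∑[ a < suc m ] (δ y (π a) * f y)    ≡⟨ sum-cong-≗ (λ y → *-distribʳ-sum (f y) (λ a → δ y (π a))) ⟨
    ∑[ y < suc m ] (weight y * f y)                    ∎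
    where open ≡-Reasoning

  weight-v : weight v ≡ 0
  weight-v = +-cancelʳ-≡ 1 (weight v) 0 (begin
    weight v + 1      ≡⟨ cong (weight v +_) (δ-refl v) ⟨
    weight v + δ v v  ≡⟨ weight-δ v ⟩
    1 + δ v z         ≡⟨ cong (1 +_) (δ-≢ (punchInᵢ≢i v z′ ∘ sym)) ⟩
    1                 ∎)
    where open ≡-Reasoning

  weight-≢ : ∀ {y} → y ≢ v → weight y ≡ 1 + δ y z
  weight-≢ {y} y≢v = begin
    weight y            ≡⟨ +-identityʳ (weight y) ⟨
    weight y + 0        ≡⟨ cong (weight y +_) (δ-≢ y≢v) ⟨
    weight y + δ y v    ≡⟨ weight-δ y ⟩
    1 + δ y z           ∎
    where open ≡-Reasoning

  -- At most one of three distinct vertices is `v` and at most one is `z`. If `v` occurs the product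
  -- vanishes; otherwise the product is 2 or 1 according to whether `z` occurs. Distinctness
  -- matters: with `z` occurring twice the product could be 4.
  weight-product : ∀ {a b c} → a ≢ b → a ≢ c → b ≢ c →
    weight a * (weight b * weight c) + (δ a v + δ b v + δ c v) ≤ 1 + (δ a z + δ b z + δ c z)
  weight-product {a} {b} {c} a≢b a≢c b≢c with a ≟ v | b ≟ v | c ≟ v
  ... | yes refl | yes refl | _        = contradiction refl a≢b
  ... | yes refl | no _     | yes refl = contradiction refl a≢c
  ... | no _     | yes refl | yes refl = contradiction refl b≢c
  ... | yes refl | no _     | no _     rewrite weight-v = s≤s z≤n
  ... | no _     | yes refl | no _     rewrite weight-v | *-zeroʳ (weight a) = s≤s z≤n
  ... | no _     | no _     | yes refl rewrite weight-v | *-zeroʳ (weight b) | *-zeroʳ (weight a) = s≤s z≤n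
  ... | no a≢v   | no b≢v   | no c≢v   rewrite weight-≢ a≢v | weight-≢ b≢v | weight-≢ c≢v
    with a ≟ z | b ≟ z | c ≟ z
  ... | yes refl | yes refl | _        = contradiction refl a≢b
  ... | yes refl | no _     | yes refl = contradiction refl a≢c
  ... | no _     | yes refl | yes refl = contradiction refl b≢c
  ... | yes _    | no _     | no _     = ≤-refl
  ... | no _     | yes _    | no _     = ≤-refl
  ... | no _     | no _     | yes _    = ≤-refl
  ... | no _     | no _     | no _     = ≤-refl

  -- Deleting `v` loses its degree and doubling `z` gains the degree of `z`. The slack comes from
  -- triples containing both, whose copies disappear with `v`.
  ∑³-π : ∀ (F : Fin (suc m) → Fin (suc m) → Fin (suc m) → ℕ) →
    (∀ {a b c} → F a b c ≢ 0 → a ≢ b × a ≢ c × b ≢ c) →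
    ∑³ (λ a b c → F (π a) (π b) (π c)) + degree F v ≤ ∑³ F + degree F z
  ∑³-π F distinct = begin
    ∑³ (λ a b c → F (π a) (π b) (π c)) + degree F v
      ≡⟨ cong₂ _+_ reweigh (degree-δ F v) ⟩
    ∑³ (λ a b c → weight a * (weight b * weight c) * F a b c) + ∑³ (λ a b c → (δ a v + δ b v + δ c v) * F a b c)
      ≡⟨ ∑³-distrib-+ (λ a b c → weight a * (weight b * weight c) * F a b c) (λ a b c → (δ a v + δ b v + δ c v) * F a b c) ⟨
    ∑³ (λ a b c → weight a * (weight b * weight c) * F a b c + (δ a v + δ b v + δ c v) * F a b c)
      ≤⟨ ∑³-mono-≤ pointwise ⟩
    ∑³ (λ a b c → F a b c + (δ a z + δ b z + δ c z) * F a b c)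
      ≡⟨ ∑³-distrib-+ F (λ a b c → (δ a z + δ b z + δ c z) * F a b c) ⟩
    ∑³ F + ∑³ (λ a b c → (δ a z + δ b z + δ c z) * F a b c)
      ≡⟨ cong (∑³ F +_) (degree-δ F z) ⟨
    ∑³ F + degree F z ∎
    where
    open ≤-Reasoning
    reweigh : ∑³ (λ a b c → F (π a) (π b) (π c)) ≡ ∑³ (λ a b c → weight a * (weight b * weight c) * F a b c)
    reweigh = begin-equality
      ∑³ (λ a b c → F (π a) (π b) (π c))
        ≡⟨ ∑-weight (λ a → ∑[ b < suc m ] ∑[ c < suc m ] F a (π b) (π c)) ⟩
      ∑[ a < suc m ] (weight a * ∑[ b < suc m ] ∑[ c < suc m ] F a (π b) (π c))
        ≡⟨ sum-cong-≗ (λ a → cong (weight a *_) (trans (∑-weight (λ b → ∑[ c < suc m ] F a b (π c)))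
             (sum-cong-≗ λ b → cong (weight b *_) (∑-weight (F a b))))) ⟩
      ∑[ a < suc m ] (weight a * ∑[ b < suc m ] (weight b * ∑[ c < suc m ] (weight c * F a b c)))
        ≡⟨ sum-cong-≗ (λ a → trans (*-distribˡ-sum (weight a) (λ b → weight b * ∑[ c < suc m ] (weight c * F a b c)))
             (sum-cong-≗ λ b → trans (sym (*-assoc (weight a) (weight b) _))
             (trans (*-distribˡ-sum (weight a * weight b) (λ c → weight c * F a b c))
             (sum-cong-≗ λ c → assoc⁴ (weight a) (weight b) (weight c) (F a b c))))) ⟩
      ∑³ (λ a b c → weight a * (weight b * weight c) * F a b c) ∎
      where
      assoc⁴ : ∀ x y z f → x * y * (z * f) ≡ x * (y * z) * f
      assoc⁴ = solve-∀
    pointwise : ∀ a b c → weight a * (weight b * weight c) * F a b c + (δ a v + δ b v + δ c v) * F a b c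
                          ≤ F a b c + (δ a z + δ b z + δ c z) * F a b c
    pointwise a b c = ≤-trans (≤-reflexive (sym (*-distribʳ-+ (F a b c) (weight a * (weight b * weight c)) (δ a v + δ b v + δ c v)))) lemma
      where
      lemma : (weight a * (weight b * weight c) + (δ a v + δ b v + δ c v)) * F a b c ≤ (1 + (δ a z + δ b z + δ c z)) * F a b c
      lemma with F a b c in eq
      ... | zero  = ≤-reflexive (trans (*-zeroʳ (weight a * (weight b * weight c) + (δ a v + δ b v + δ c v))) (sym (*-zeroʳ (1 + (δ a z + δ b z + δ c z)))))
      ... | suc f with a≢b , a≢c , b≢c ← distinct {a} {b} {c} (λ F≡0 → contradiction (trans (sym eq) F≡0) λ ())
        = *-monoˡ-≤ (suc f) (weight-product a≢b a≢c b≢c)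

  Collide? : ∀ a b → Dec (a F.< b × π a ≡ π b)
  Collide? a b = (a <? b) ×-dec (π a ≟ π b)

  -- All ordered pairs with equal images number the sum of the squared fibre sizes, which is
  -- `suc m + 2`. The diagonal takes `suc m` of them, and the remaining 2 bound the pairs with `a`
  -- before `b`.
  ∑-collide : ∑[ a < suc m ] ∑[ b < suc m ] 𝟙 (Collide? a b) ≤ 2
  ∑-collide = +-cancelˡ-≤ (suc m) _ _ (begin
    suc m + ∑[ a < suc m ] ∑[ b < suc m ] 𝟙 (Collide? a b)
      ≡⟨ cong (_+ collisions) (trans (sum-cong-≗ (∑-δ {suc m})) (trans (∑-const (suc m) 1) (*-identityʳ (suc m)))) ⟨
    ∑[ b < suc m ] ∑[ a < suc m ] δ a b + ∑[ a < suc m ] ∑[ b < suc m ] 𝟙 (Collide? a b)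
      ≡⟨ cong (_+ collisions) (∑-comm {suc m} {suc m} (λ b a → δ a b)) ⟩
    ∑[ a < suc m ] ∑[ b < suc m ] δ a b + ∑[ a < suc m ] ∑[ b < suc m ] 𝟙 (Collide? a b)
      ≡⟨ trans (sum-cong-≗ λ a → ∑-distrib-+ (δ a) (λ b → 𝟙 (Collide? a b))) (∑-distrib-+ (λ a → sum (δ a)) (λ a → ∑[ b < suc m ] 𝟙 (Collide? a b))) ⟨
    ∑[ a < suc m ] ∑[ b < suc m ] (δ a b + 𝟙 (Collide? a b))
      ≤⟨ ∑-mono-≤ (λ a → ∑-mono-≤ (pointwise a)) ⟩
    ∑[ a < suc m ] weight (π a)
      ≤⟨ m≤m+n _ (weight v) ⟩
    ∑[ a < suc m ] weight (π a) + weight v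
      ≡⟨ ∑-π weight ⟩
    sum weight + weight z
      ≡⟨ cong₂ _+_ ∑-weights (trans (weight-≢ (punchInᵢ≢i v z′)) (cong suc (δ-refl z))) ⟩
    suc m + 2 ∎)
    where
    open ≤-Reasoning
    collisions = ∑[ a < suc m ] ∑[ b < suc m ] 𝟙 (Collide? a b)
    ∑-weights : sum weight ≡ suc m
    ∑-weights = begin-equality
      sum weight                        ≡⟨ ∑-comm (λ y a → δ y (π a)) ⟩
      ∑[ a < suc m ] ∑[ y < suc m ] δ y (π a)  ≡⟨ sum-cong-≗ (∑-δ ∘ π) ⟩
      ∑[ a < suc m ] 1                  ≡⟨ ∑-const (suc m) 1 ⟩
      suc m * 1                         ≡⟨ *-identityʳ (suc m) ⟩
      suc m                             ∎
    pointwise : ∀ a b → δ a b + 𝟙 (Collide? a b) ≤ δ (π a) (π b)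
    pointwise a b with a ≟ b
    ... | yes refl rewrite δ-refl (π a) | 𝟙-no (Collide? a a) (λ (a<a , _) → <-irrefl refl a<a) = ≤-refl
    ... | no _ = 𝟙-least (Collide? a b) λ (_ , πa≡πb) → ≤-reflexive (sym (𝟙-yes (π a ≟ π b) πa≡πb))

-- Thresholds and the balance of the bad-triple degrees

module Threshold {k m} (φ : Labeling (suc k) (suc m)) (mono : Monotone φ) where

  -- The default `zero` is the least label, so it neither raises the maximum over the true in-labels
  -- nor exceeds any out-label.
  inLabel : Fin (suc m) → Fin (suc m) → Fin (suc k)
  inLabel v u with u <? v
  ... | yes u<v = φ u v u<v
  ... | no  _   = zero

  -- The smallest admissible threshold: the largest in-label, or `zero` if no edge enters `v`.
  c : Fin (suc m) → Fin (suc k)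
  c v = inLabel v (proj₁ (argmax (toℕ ∘ inLabel v)))

  in≤c : ∀ u v (u<v : u F.< v) → φ u v u<v F.≤ c v
  in≤c u v u<v = ≤-trans (≤-reflexive (cong toℕ φ≡in)) (proj₂ (argmax (toℕ ∘ inLabel v)) u)
    where
    φ≡in : φ u v u<v ≡ inLabel v u
    φ≡in with u <? v
    ... | yes _   = refl
    ... | no  u≮v = contradiction u<v u≮v

  -- The maximum is attained at some `u`; if the edge from `u` to `v` exists, monotonicity along
  -- `u`, `v`, `w` applies, and otherwise the value is `zero`.
  c≤out : ∀ v w (v<w : v F.< w) → c v F.≤ φ v w v<w
  c≤out v w v<w = in≤out (proj₁ (argmax (toℕ ∘ inLabel v)))
    where
    in≤out : ∀ u → inLabel v u F.≤ φ v w v<w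
    in≤out u with u <? v
    ... | yes u<v = mono u v w u<v v<w
    ... | no  _   = z≤n

  module _ (v : Fin (suc m)) (z′ : Fin m) where
    open Replace v z′

    -- The labeling after `v` is deleted and `z` doubled, pulled back along `π`. The edge between
    -- the two copies of `z` has no label to inherit; it gets `c z`, which lies between the
    -- in-labels and the out-labels of `z` and so preserves monotonicity.
    ψ : Labeling (suc k) (suc m)
    ψ a b _ with π a <? π b
    ... | yes πa<πb = φ (π a) (π b) πa<πb
    ... | no  _     = c (π a)

    π-≮ : ∀ {a b} → a F.< b → ¬ (π a F.< π b) → π a ≡ π b
    π-≮ a<b πa≮πb = Finₚ.≤-antisym (π-mono (<⇒≤ a<b)) (≮⇒≥ πa≮πb)

    ψ-mono : Monotone ψ
    ψ-mono a b d a<b b<d with π a <? π b | π b <? π d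
    ... | yes p | yes q = mono (π a) (π b) (π d) p q
    ... | yes p | no  _ = in≤c (π a) (π b) p
    ... | no  p | yes q = ≤-trans (≤-reflexive (cong (toℕ ∘ c) (π-≮ a<b p))) (c≤out (π b) (π d) q)
    ... | no  p | no  _ = ≤-reflexive (cong (toℕ ∘ c) (π-≮ a<b p))

    -- Triples in which the two copies of `z` are consecutive are written off as possibly bad; the
    -- others inherit their labels from `φ`.
    bad-ψ : ∀ {a b d} → Bad ψ (a , b , d) →
            Bad φ (π a , π b , π d) ⊎ (a F.< b × π a ≡ π b) ⊎ (b F.< d × π b ≡ π d)
    bad-ψ {a} {b} {d} (a<b , b<d , ¬good) with π a <? π b | π b <? π d
    ... | no p  | _     = inj₂ (inj₁ (a<b , π-≮ a<b p))
    ... | yes _ | no q  = inj₂ (inj₂ (b<d , π-≮ b<d q))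
    ... | yes p | yes q = inj₁ (p , q , ¬good)

    B-ψ : ∀ a b d → B ψ a b d ≤ B φ (π a) (π b) (π d) + 𝟙 (Collide? a b) + 𝟙 (Collide? b d)
    B-ψ a b d = 𝟙-least (bad? ψ (a , b , d)) (main ∘ bad-ψ)
      where
      main : Bad φ (π a , π b , π d) ⊎ (a F.< b × π a ≡ π b) ⊎ (b F.< d × π b ≡ π d) →
             1 ≤ B φ (π a) (π b) (π d) + 𝟙 (Collide? a b) + 𝟙 (Collide? b d)
      main (inj₁ p)        rewrite 𝟙-yes (bad? φ (π a , π b , π d)) p = s≤s z≤n
      main (inj₂ (inj₁ p)) rewrite 𝟙-yes (Collide? a b) p = m≤n⇒m≤n+o _ (m≤n+m 1 (B φ (π a) (π b) (π d)))
      main (inj₂ (inj₂ p)) rewrite 𝟙-yes (Collide? b d) p = m≤n+m 1 _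

    -- The error term comes from the triples containing both copies of `z`: two positions for the
    -- consecutive pair, at most 2 pairs by `∑-collide`, and `suc m` choices of the remaining
    -- vertex.
    badCount-ψ : badCount ψ + degree (B φ) v ≤ badCount φ + degree (B φ) z + 4 * suc m
    badCount-ψ = begin
      badCount ψ + degree (B φ) v
        ≡⟨ cong (_+ degree (B φ) v) (badCount≡∑B ψ) ⟩
      ∑³ (B ψ) + degree (B φ) v
        ≤⟨ +-monoˡ-≤ (degree (B φ) v) (∑³-mono-≤ B-ψ) ⟩
      ∑³ (λ a b d → B φ (π a) (π b) (π d) + 𝟙 (Collide? a b) + 𝟙 (Collide? b d)) + degree (B φ) v
        ≡⟨ cong (_+ degree (B φ) v) (∑³-distrib-+₃ (λ a b d → B φ (π a) (π b) (π d)) (λ a b d → 𝟙 (Collide? a b)) (λ a b d → 𝟙 (Collide? b d))) ⟩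
      ∑³ (λ a b d → B φ (π a) (π b) (π d)) + ∑³ (λ a b d → 𝟙 (Collide? a b)) + ∑³ (λ a b d → 𝟙 (Collide? b d)) + degree (B φ) v
        ≡⟨ rotate (∑³ (λ a b d → B φ (π a) (π b) (π d))) (∑³ (λ a b d → 𝟙 (Collide? a b))) (∑³ (λ a b d → 𝟙 (Collide? b d))) (degree (B φ) v) ⟩
      ∑³ (λ a b d → B φ (π a) (π b) (π d)) + degree (B φ) v + (∑³ (λ a b d → 𝟙 (Collide? a b)) + ∑³ (λ a b d → 𝟙 (Collide? b d)))
        ≤⟨ +-mono-≤ (∑³-π (B φ) distinct) (+-mono-≤ collisionˡ collisionʳ) ⟩
      ∑³ (B φ) + degree (B φ) z + (suc m * 2 + suc m * 2)
        ≡⟨ cong₂ (λ s t → s + degree (B φ) z + t) (sym (badCount≡∑B φ)) (double (suc m)) ⟩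
      badCount φ + degree (B φ) z + 4 * suc m ∎
      where
      open ≤-Reasoning
      rotate : ∀ w x y z → w + x + y + z ≡ w + z + (x + y)
      rotate = solve-∀
      double : ∀ n → n * 2 + n * 2 ≡ 4 * n
      double = solve-∀
      distinct : ∀ {a b c} → B φ a b c ≢ 0 → a ≢ b × a ≢ c × b ≢ c
      distinct {a} {b} {c} B≢0 with bad? φ (a , b , c)
      ... | yes (a<b , b<c , _) = Finₚ.<⇒≢ a<b , Finₚ.<⇒≢ (<-trans a<b b<c) , Finₚ.<⇒≢ b<c
      ... | no _ = contradiction refl B≢0
      collisionʳ : ∑³ (λ a b d → 𝟙 (Collide? b d)) ≤ suc m * 2
      collisionʳ = ∑-bounded {suc m} 2 λ _ → ∑-collide
      collisionˡ : ∑³ (λ a b d → 𝟙 (Collide? a b)) ≤ suc m * 2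
      collisionˡ = begin
        ∑³ (λ a b d → 𝟙 (Collide? a b))
          ≡⟨ sum-cong-≗ {suc m} (λ a → trans (sum-cong-≗ λ b → ∑-const (suc m) (𝟙 (Collide? a b))) (sym (*-distribˡ-sum (suc m) (λ b → 𝟙 (Collide? a b))))) ⟩
        ∑[ a < suc m ] (suc m * ∑[ b < suc m ] 𝟙 (Collide? a b))
          ≡⟨ *-distribˡ-sum (suc m) (λ a → ∑[ b < suc m ] 𝟙 (Collide? a b)) ⟨
        suc m * ∑[ a < suc m ] ∑[ b < suc m ] 𝟙 (Collide? a b)
          ≤⟨ *-monoʳ-≤ (suc m) ∑-collide ⟩
        suc m * 2 ∎

  -- By minimality `badCount φ` is at most the count for the labeling that replaces `v` by a copy of
  -- `w`, so it cancels from `badCount-ψ`.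
  degree-balanced : MinimizesBad φ → ∀ v w → degree (B φ) v ≤ degree (B φ) w + 4 * suc m
  degree-balanced (_ , minimal) v w with v ≟ w
  ... | yes refl = m≤m+n _ _
  ... | no  v≢w  = subst (λ w → degree (B φ) v ≤ degree (B φ) w + 4 * suc m) (punchIn-punchOut v≢w)
    (+-cancelˡ-≤ (badCount φ) _ _ (≤-trans (+-monoˡ-≤ _ (minimal (ψ v w′) (ψ-mono v w′)))
      (≤-trans (badCount-ψ v w′) (≤-reflexive (+-assoc (badCount φ) _ _)))))
    where w′ = punchOut v≢w

-- Areas of the gaps between consecutive classes

module Areas {k m} (φ : Labeling (suc k) (suc m)) (mono : Monotone φ) where
  open Threshold φ mono

  private
    -- The labels `Fin (suc k)` give `suc k` classes, hence `K` gaps with the two outer ones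
    -- included.
    n K : ℕ
    n = suc m
    K = suc (suc k)

  In Out : Fin n → Fin n → Set
  In  x u = Σ[ x<u ∈ x F.< u ] φ x u x<u ≡ c u
  Out u x = Σ[ u<x ∈ u F.< x ] φ u x u<x ≡ c u

  in? : ∀ x u → Dec (In x u)
  in? x u with x <? u
  ... | no  x≮u = no (x≮u ∘ proj₁)
  ... | yes x<u with φ x u x<u ≟ c u
  ...   | yes eq = yes (x<u , eq)
  ...   | no  ne = no (ne ∘ proj₂)

  out? : ∀ u x → Dec (Out u x)
  out? u x with u <? x
  ... | no  u≮x = no (u≮x ∘ proj₁)
  ... | yes u<x with φ u x u<x ≟ c u
  ...   | yes eq = yes (u<x , eq)
  ...   | no  ne = no (ne ∘ proj₂)

  L R : Fin n → ℕ
  L u = ∑[ x < n ] 𝟙 (in? x u)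
  R u = ∑[ x < n ] 𝟙 (out? u x)

  in-out⇒bad : ∀ {x u v} → In x u → Out u v → Bad φ (x , u , v)
  in-out⇒bad (x<u , xu≡c) (u<v , uv≡c) = x<u , u<v , <-irrefl (cong toℕ (trans xu≡c (sym uv≡c)))

  -- Every in-edge counted by `L u` has the same label `c u` as the edge from `u` to `v` and forms a
  -- bad triple with it.
  L≤ : ∀ {u v} → Out u v → L u ≤ ∑[ x < n ] B φ x u v
  L≤ {u} {v} uv = ∑-mono-≤ λ x → 𝟙-least (in? x u) λ xu →
    ≤-reflexive (sym (𝟙-yes (bad? φ (x , u , v)) (in-out⇒bad xu uv)))

  R≤ : ∀ {u v} → In v u → R u ≤ ∑[ x < n ] B φ v u x
  R≤ {u} {v} vu = ∑-mono-≤ λ x → 𝟙-least (out? u x) λ ux →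
    ≤-reflexive (sym (𝟙-yes (bad? φ (v , u , x)) (in-out⇒bad vu ux)))

  L≤n : ∀ u → L u ≤ n
  L≤n u = ≤-trans (∑-bounded 1 λ x → 𝟙≤1 (in? x u)) (≤-reflexive (*-identityʳ n))

  R≤n : ∀ u → R u ≤ n
  R≤n u = ≤-trans (∑-bounded 1 λ x → 𝟙≤1 (out? u x)) (≤-reflexive (*-identityʳ n))

  c-mono : ∀ {u v} → u F.< v → c u F.≤ c v
  c-mono {u} {v} u<v = ≤-trans (c≤out u v u<v) (in≤c u v u<v)

  c-cancel-< : ∀ {u v} → c u F.< c v → u F.< v
  c-cancel-< {u} {v} cu<cv with Finₚ.<-cmp u v
  ... | tri< u<v _ _  = u<v
  ... | tri≈ _ refl _ = contradiction cu<cv (<-irrefl refl)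
  ... | tri> _ _ v<u  = contradiction (c-mono v<u) (<⇒≱ cu<cv)

  same-out : ∀ {u v} → u F.< v → c u ≡ c v → Out u v
  same-out {u} {v} u<v cu≡cv = u<v , Finₚ.≤-antisym (≤-trans (in≤c u v u<v) (≤-reflexive (cong toℕ (sym cu≡cv)))) (c≤out u v u<v)

  same-in : ∀ {u v} → u F.< v → c u ≡ c v → In u v
  same-in u<v cu≡cv with u<v , φ≡cu ← same-out u<v cu≡cv = u<v , trans φ≡cu cu≡cv

  -- The label of the edge lies between two consecutive thresholds, so it equals one of them.
  adjacent : ∀ {u v} → suc (c u) ≡ inject₁ (c v) → Out u v ⊎ In u v
  adjacent {u} {v} eq = squeeze (m≤n⇒m<n∨m≡n (c≤out u v u<v))
    where
    1+cu≡cv : suc (toℕ (c u)) ≡ toℕ (c v)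
    1+cu≡cv = trans (cong toℕ eq) (toℕ-inject₁ (c v))
    u<v : u F.< v
    u<v = c-cancel-< (≤-reflexive 1+cu≡cv)
    squeeze : c u F.< φ u v u<v ⊎ toℕ (c u) ≡ toℕ (φ u v u<v) → Out u v ⊎ In u v
    squeeze (inj₂ cu≡φ) = inj₁ (u<v , toℕ-injective (sym cu≡φ))
    squeeze (inj₁ cu<φ) = inj₂ (u<v , Finₚ.≤-antisym (in≤c u v u<v) (≤-trans (≤-reflexive (sym 1+cu≡cv)) cu<φ))

  suc≢inject₁ : ∀ {j} (x : Fin j) → suc x ≢ inject₁ x
  suc≢inject₁ x eq = 1+n≢n (trans (cong toℕ eq) (toℕ-inject₁ x))

  -- i : Fin K stands for the gap between the classes i - 1 and i; L is charged to the gap above the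
  -- class of u and R to the gap below it.
  share : Fin K → Fin n → ℕ
  share i u = δ i (suc (c u)) * L u + δ i (inject₁ (c u)) * R u

  share-view : ∀ i u → (i ≡ suc (c u) × share i u ≡ L u) ⊎ (i ≡ inject₁ (c u) × share i u ≡ R u) ⊎ share i u ≡ 0
  share-view i u with i ≟ suc (c u) | i ≟ inject₁ (c u)
  ... | yes p | yes q = contradiction (trans (sym p) q) (suc≢inject₁ (c u))
  ... | yes p | no _  = inj₁ (p , trans (+-identityʳ _) (+-identityʳ (L u)))
  ... | no _  | yes q = inj₂ (inj₁ (q , +-identityʳ (R u)))
  ... | no _  | no _  = inj₂ (inj₂ refl)

  ∑-share : ∀ u → ∑[ i < K ] share i u ≡ L u + R u
  ∑-share u = trans (∑-distrib-+ (λ i → δ i (suc (c u)) * L u) (λ i → δ i (inject₁ (c u)) * R u))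
    (cong₂ _+_ (∑-δˡ (suc (c u)) (λ _ → L u)) (∑-δˡ (inject₁ (c u)) (λ _ → R u)))

  module _ (v : Fin n) where

    first last : Fin n → ℕ
    first u = ∑[ x < n ] B φ v u x
    last  u = ∑[ x < n ] B φ x u v

    -- The bad triples through v are sorted by a second vertex u, which for the triples with v
    -- in the middle may be taken to be either the first or the third one.
    ∑≤degree : ∀ (g middle : Fin n → ℕ) → sum middle ≡ ∑[ a < n ] ∑[ b < n ] B φ a v b →
      (∀ u → g u ≤ first u + middle u + last u + δ u v * n) → sum g ≤ degree (B φ) v + n
    ∑≤degree g middle ∑-middle g≤ = begin
      sum g
        ≤⟨ ∑-mono-≤ g≤ ⟩
      ∑[ u < n ] (first u + middle u + last u + δ u v * n)
        ≡⟨ ∑-distrib-+ (λ u → first u + middle u + last u) (λ u → δ u v * n) ⟩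
      ∑[ u < n ] (first u + middle u + last u) + ∑[ u < n ] (δ u v * n)
        ≡⟨ cong₂ _+_ (∑-distrib-+₃ first middle last) (∑-δˡ v (λ _ → n)) ⟩
      sum first + sum middle + sum last + n
        ≡⟨ cong₂ (λ x y → sum first + x + y + n) ∑-middle (∑-comm (λ u x → B φ x u v)) ⟩
      degree (B φ) v + n ∎
      where open ≤-Reasoning

    module Via (i : Fin K) (middle : Fin n → ℕ) (max : ∀ u → share i u ≤ share i v) where

      viaFirst : ∀ u {x} → share i u ≡ x → x ≤ first u → share i u ≤ first u + middle u + last u + δ u v * n
      viaFirst u refl x≤ = m≤n⇒m≤n+o _ (m≤n⇒m≤n+o _ (m≤n⇒m≤n+o _ x≤))

      viaLast : ∀ u {x} → share i u ≡ x → x ≤ last u → share i u ≤ first u + middle u + last u + δ u v * n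
      viaLast u refl x≤ = m≤n⇒m≤n+o _ (m≤n⇒m≤o+n (first u + middle u) x≤)

      -- Maximality of `v` enters here: the share of `u` is exchanged for the share of `v`, which
      -- bad triples with `v` in the middle can pay for.
      viaMiddle : ∀ u {x} → share i v ≡ x → x ≤ middle u → share i u ≤ first u + middle u + last u + δ u v * n
      viaMiddle u refl x≤ = m≤n⇒m≤n+o _ (m≤n⇒m≤n+o _ (m≤n⇒m≤o+n (first u) (≤-trans (max u) x≤)))

      -- No bad triple repeats a vertex, so the share of `v` itself is paid for by the extra term
      -- `δ u v * n`.
      viaSelf : ∀ {x} → share i v ≡ x → x ≤ n → share i v ≤ first v + middle v + last v + δ v v * n
      viaSelf refl x≤ = m≤n⇒m≤o+n (first v + middle v + last v)
        (≤-trans x≤ (≤-reflexive (sym (trans (cong (_* n) (δ-refl v)) (+-identityʳ n)))))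

    -- Here `v` lies just below the gap. For `u` just above it, the edge from `v` to `u` has label
    -- `c v` or `c u`, giving `L v` bad triples with middle `v` or `R u` with middle `u`. For `u` in
    -- the class of `v`, the earlier of the two serves as the middle. Triples with middle `v` are
    -- sorted by their third vertex, so none is counted twice.
    area≤degreeˡ : ∀ {i} → (∀ u → share i u ≤ share i v) → i ≡ suc (c v) → share i v ≡ L v → ∑[ u < n ] share i u ≤ degree (B φ) v + n
    area≤degreeˡ {i} max i≡ share-v≡L = ∑≤degree (share i) middle (∑-comm (λ u x → B φ x v u)) pointwise
      where
      middle : Fin n → ℕ
      middle u = ∑[ x < n ] B φ x v u
      open Via i middle max
      pointwise : ∀ u → share i u ≤ first u + middle u + last u + δ u v * n
      pointwise u with share-view i u
      ... | inj₂ (inj₂ share≡0) = ≤-trans (≤-reflexive share≡0) z≤n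
      ... | inj₂ (inj₁ (i≡′ , share≡R)) with adjacent {v} {u} (trans (sym i≡) i≡′)
      ...   | inj₁ vu = viaMiddle u share-v≡L (L≤ vu)
      ...   | inj₂ vu = viaFirst u share≡R (R≤ vu)
      pointwise u | inj₁ (i≡′ , share≡L) with Finₚ.<-cmp u v
      ...   | tri> _ _ v<u  = viaMiddle u share-v≡L (L≤ (same-out v<u (Finₚ.suc-injective (trans (sym i≡) i≡′))))
      ...   | tri< u<v _ _  = viaLast u share≡L (L≤ (same-out u<v (Finₚ.suc-injective (trans (sym i≡′) i≡))))
      ...   | tri≈ _ refl _ = viaSelf share≡L (L≤n v)

    -- The mirror image: `v` lies just above the gap, and triples with middle `v` are sorted by
    -- their first vertex.
    area≤degreeʳ : ∀ {i} → (∀ u → share i u ≤ share i v) → i ≡ inject₁ (c v) → share i v ≡ R v → ∑[ u < n ] share i u ≤ degree (B φ) v + n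
    area≤degreeʳ {i} max i≡ share-v≡R = ∑≤degree (share i) middle refl pointwise
      where
      middle : Fin n → ℕ
      middle u = ∑[ x < n ] B φ u v x
      open Via i middle max
      pointwise : ∀ u → share i u ≤ first u + middle u + last u + δ u v * n
      pointwise u with share-view i u
      ... | inj₂ (inj₂ share≡0) = ≤-trans (≤-reflexive share≡0) z≤n
      ... | inj₁ (i≡′ , share≡L) with adjacent {u} {v} (trans (sym i≡′) i≡)
      ...   | inj₂ uv = viaMiddle u share-v≡R (R≤ uv)
      ...   | inj₁ uv = viaLast u share≡L (L≤ uv)
      pointwise u | inj₂ (inj₁ (i≡′ , share≡R)) with Finₚ.<-cmp u v
      ...   | tri< u<v _ _  = viaMiddle u share-v≡R (R≤ (same-in u<v (Finₚ.inject₁-injective (trans (sym i≡′) i≡))))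
      ...   | tri> _ _ v<u  = viaFirst u share≡R (R≤ (same-in v<u (Finₚ.inject₁-injective (trans (sym i≡) i≡′))))
      ...   | tri≈ _ refl _ = viaSelf share≡R (R≤n v)

  area≤degree : ∀ i → ∃[ v ] ∑[ u < n ] share i u ≤ degree (B φ) v + n
  area≤degree i with v , max ← argmax (share i) with share-view i v
  ... | inj₁ (i≡ , f≡)        = v , area≤degreeˡ v max i≡ f≡
  ... | inj₂ (inj₁ (i≡ , f≡)) = v , area≤degreeʳ v max i≡ f≡
  ... | inj₂ (inj₂ share≡0)       = v , ≤-trans (∑-bounded 0 λ u → ≤-trans (max u) (≤-reflexive share≡0)) (≤-trans (≤-reflexive (*-zeroʳ n)) z≤n)

  -- Upper and lower bounds on the sum `S` of all areas

  S : ℕ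
  S = ∑[ u < n ] (L u + R u)

  -- Each area is bounded by the degree of a vertex of its own; balance transfers all these bounds
  -- to one arbitrary `w`, and summing over `w` turns degrees into `3 * badCount φ`.
  S-upper : MinimizesBad φ → n * S ≤ K * (3 * badCount φ + n * (5 * n))
  S-upper minimal = begin
    n * S
      ≡⟨ ∑-const n S ⟨
    ∑[ w < n ] S
      ≤⟨ ∑-mono-≤ (λ w → begin
           S                                     ≡⟨ sum-cong-≗ ∑-share ⟨
           ∑[ u < n ] ∑[ i < K ] share i u           ≡⟨ ∑-comm (λ u i → share i u) ⟩
           ∑[ i < K ] ∑[ u < n ] share i u           ≤⟨ ∑-bounded _ (λ i → area i w) ⟩
           K * (degree (B φ) w + 5 * n)          ∎) ⟩
    ∑[ w < n ] (K * (degree (B φ) w + 5 * n))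
      ≡⟨ *-distribˡ-sum K (λ w → degree (B φ) w + 5 * n) ⟨
    K * ∑[ w < n ] (degree (B φ) w + 5 * n)
      ≡⟨ cong (K *_) (trans (∑-distrib-+ (degree (B φ)) (λ _ → 5 * n)) (cong₂ _+_ (trans (∑-degree (B φ)) (cong (3 *_) (sym (badCount≡∑B φ)))) (∑-const n (5 * n)))) ⟩
    K * (3 * badCount φ + n * (5 * n)) ∎
    where
    open ≤-Reasoning
    4+1 : ∀ d n → d + 4 * n + n ≡ d + 5 * n
    4+1 = solve-∀
    -- The error `5 * n` is `4 * n` from balancing plus `n` from the share of the maximal vertex
    -- itself.
    area : ∀ i w → ∑[ u < n ] share i u ≤ degree (B φ) w + 5 * n
    area i w with v , area≤ ← area≤degree i =
      ≤-trans area≤ (≤-trans (+-monoˡ-≤ n (degree-balanced minimal v w)) (≤-reflexive (4+1 (degree (B φ) w) n)))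

  -- The indicator that `u` lies in the union of the two classes bordering the gap `i`.
  meets : Fin K → Fin n → ℕ
  meets i u = δ i (suc (c u)) + δ i (inject₁ (c u))

  meets≤1 : ∀ i u → meets i u ≤ 1
  meets≤1 i u with i ≟ suc (c u)
  ... | no _     = 𝟙≤1 (i ≟ inject₁ (c u))
  ... | yes refl = ≤-reflexive (cong suc (δ-≢ (suc≢inject₁ (c u))))

  ∑-meets : ∀ u → ∑[ i < K ] meets i u ≡ 2
  ∑-meets u = trans (∑-distrib-+ (λ i → δ i (suc (c u))) (λ i → δ i (inject₁ (c u)))) (cong₂ _+_ (∑-δ (suc (c u))) (∑-δ (inject₁ (c u))))

  -- The value is 2 within a class, 1 between consecutive classes and 0 otherwise.
  common : Fin n → Fin n → ℕ
  common u v = ∑[ i < K ] (meets i u * meets i v)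

  common≡ : ∀ u v → common u v ≡ meets (suc (c u)) v + meets (inject₁ (c u)) v
  common≡ u v = trans (sum-cong-≗ λ i → *-distribʳ-+ (meets i v) (δ i (suc (c u))) (δ i (inject₁ (c u))))
    (trans (∑-distrib-+ (λ i → δ i (suc (c u)) * meets i v) (λ i → δ i (inject₁ (c u)) * meets i v))
      (cong₂ _+_ (∑-δˡ (suc (c u)) (λ i → meets i v)) (∑-δˡ (inject₁ (c u)) (λ i → meets i v))))

  common≤2 : ∀ u v → common u v ≤ 2
  common≤2 u v = ≤-trans (≤-reflexive (common≡ u v)) (+-mono-≤ (meets≤1 (suc (c u)) v) (meets≤1 (inject₁ (c u)) v))

  common-sym : ∀ u v → common u v ≡ common v u
  common-sym u v = sum-cong-≗ λ i → *-comm (meets i u) (meets i v)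

  ends : Fin n → Fin n → ℕ
  ends u v = 𝟙 (out? u v) + 𝟙 (in? u v)

  -- An edge within a class carries the threshold of both its ends and is counted twice by `ends`;
  -- between consecutive classes `adjacent` gives at least one; for classes further apart `common`
  -- vanishes.
  common-< : ∀ {u v} → u F.< v → common u v ≤ ends u v
  common-< {u} {v} u<v with m≤n⇒m<n∨m≡n (c-mono u<v)
  ... | inj₂ cu≡cv = ≤-trans (common≤2 u v) (≤-reflexive (sym (cong₂ _+_
          (𝟙-yes (out? u v) (same-out u<v (toℕ-injective cu≡cv))) (𝟙-yes (in? u v) (same-in u<v (toℕ-injective cu≡cv))))))
  ... | inj₁ cu<cv = begin
    common u v
      ≡⟨ common≡ u v ⟩
    δ (suc (c u)) (suc (c v)) + δ (suc (c u)) (inject₁ (c v)) + (δ (inject₁ (c u)) (suc (c v)) + δ (inject₁ (c u)) (inject₁ (c v)))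
      ≡⟨ cong₂ (λ x y → x + δ (suc (c u)) (inject₁ (c v)) + y) (δ-≢ (cu≢cv ∘ Finₚ.suc-injective))
           (cong₂ _+_ (δ-≢ inj≢suc) (δ-≢ (cu≢cv ∘ Finₚ.inject₁-injective))) ⟩
    δ (suc (c u)) (inject₁ (c v)) + 0
      ≡⟨ +-identityʳ _ ⟩
    δ (suc (c u)) (inject₁ (c v))
      ≤⟨ 𝟙-least (suc (c u) ≟ inject₁ (c v)) (λ eq → counted (adjacent eq)) ⟩
    ends u v ∎
    where
    open ≤-Reasoning
    cu≢cv : c u ≢ c v
    cu≢cv eq = <-irrefl (cong toℕ eq) cu<cv
    inj≢suc : inject₁ (c u) ≢ suc (c v)
    inj≢suc eq = <-irrefl (trans (sym (toℕ-inject₁ (c u))) (cong toℕ eq)) (m<n⇒m<1+n cu<cv)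
    counted : Out u v ⊎ In u v → 1 ≤ ends u v
    counted (inj₁ out) = m≤n⇒m≤n+o _ (≤-reflexive (sym (𝟙-yes (out? u v) out)))
    counted (inj₂ inn) = m≤n⇒m≤o+n (𝟙 (out? u v)) (≤-reflexive (sym (𝟙-yes (in? u v) inn)))

  common≤ : ∀ u v → common u v ≤ ends u v + ends v u + δ u v * 2
  common≤ u v with Finₚ.<-cmp u v
  ... | tri< u<v _ _  = m≤n⇒m≤n+o _ (m≤n⇒m≤n+o _ (common-< u<v))
  ... | tri> _ _ v<u  = m≤n⇒m≤n+o _ (m≤n⇒m≤o+n (ends u v) (≤-trans (≤-reflexive (common-sym u v)) (common-< v<u)))
  ... | tri≈ _ refl _ = m≤n⇒m≤o+n (ends u u + ends u u) (≤-trans (common≤2 u u) (≤-reflexive (cong (_* 2) (sym (δ-refl u)))))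

  ∑∑-ends : ∑[ u < n ] ∑[ v < n ] ends u v ≡ S
  ∑∑-ends = begin
    ∑[ u < n ] ∑[ v < n ] ends u v
      ≡⟨ sum-cong-≗ (λ u → ∑-distrib-+ (λ v → 𝟙 (out? u v)) (λ v → 𝟙 (in? u v))) ⟩
    ∑[ u < n ] (R u + ∑[ v < n ] 𝟙 (in? u v))
      ≡⟨ ∑-distrib-+ R (λ u → ∑[ v < n ] 𝟙 (in? u v)) ⟩
    sum R + ∑[ u < n ] ∑[ v < n ] 𝟙 (in? u v)
      ≡⟨ cong (sum R +_) (∑-comm (λ u v → 𝟙 (in? u v))) ⟩
    sum R + sum L
      ≡⟨ +-comm (sum R) (sum L) ⟩
    sum L + sum R
      ≡⟨ ∑-distrib-+ L R ⟨
    S ∎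
    where open ≡-Reasoning

  S-lower : (n * 2) * (n * 2) ≤ K * (S + S + n * 2)
  S-lower = begin
    (n * 2) * (n * 2)
      ≡⟨ cong₂ _*_ ∑-a ∑-a ⟨
    sum a * sum a
      ≤⟨ ∑-Cauchy-Schwarz a ⟩
    K * ∑[ i < K ] (a i * a i)
      ≡⟨ cong (K *_) ∑-a² ⟩
    K * ∑[ u < n ] ∑[ v < n ] common u v
      ≤⟨ *-monoʳ-≤ K (∑-mono-≤ λ u → ∑-mono-≤ λ v → common≤ u v) ⟩
    K * ∑[ u < n ] ∑[ v < n ] (ends u v + ends v u + δ u v * 2)
      ≡⟨ cong (K *_) (trans (sum-cong-≗ λ u → ∑-distrib-+₃ (ends u) (λ v → ends v u) (λ v → δ u v * 2))
           (∑-distrib-+₃ (λ u → sum (ends u)) (λ u → ∑[ v < n ] ends v u) (λ u → ∑[ v < n ] (δ u v * 2)))) ⟩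
    K * (∑[ u < n ] ∑[ v < n ] ends u v + ∑[ u < n ] ∑[ v < n ] ends v u + ∑[ u < n ] ∑[ v < n ] (δ u v * 2))
      ≡⟨ cong (K *_) (cong₂ _+_ (cong₂ _+_ ∑∑-ends (trans (∑-comm (λ u v → ends v u)) ∑∑-ends))
           (trans (∑-comm {n} {n} (λ u v → δ u v * 2)) (trans (sum-cong-≗ {n} λ v → ∑-δˡ v (λ _ → 2)) (∑-const n 2)))) ⟩
    K * (S + S + n * 2) ∎
    where
    open ≤-Reasoning
    a : Fin K → ℕ
    a i = ∑[ u < n ] meets i u
    ∑-a : sum a ≡ n * 2
    ∑-a = trans (∑-comm meets) (trans (sum-cong-≗ ∑-meets) (∑-const n 2))
    -- The square of `a i` counts ordered pairs in the union of the classes around gap `i`; summing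
    -- over the gaps first leaves `common u v` for each pair.
    ∑-a² : ∑[ i < K ] (a i * a i) ≡ ∑[ u < n ] ∑[ v < n ] common u v
    ∑-a² = begin-equality
      ∑[ i < K ] (a i * a i)
        ≡⟨ sum-cong-≗ (λ i → trans (*-distribʳ-sum (a i) (meets i)) (sum-cong-≗ λ u → *-distribˡ-sum (meets i u) (meets i))) ⟩
      ∑[ i < K ] ∑[ u < n ] ∑[ v < n ] (meets i u * meets i v)
        ≡⟨ trans (∑-comm (λ i u → ∑[ v < n ] (meets i u * meets i v))) (sum-cong-≗ λ u → ∑-comm (λ i v → meets i u * meets i v)) ⟩
      ∑[ u < n ] ∑[ v < n ] common u v ∎

  badCount-lower : MinimizesBad φ → 4 * (n * n * n) ≤ K * K * (6 * badCount φ + 12 * (n * n))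
  badCount-lower minimal = begin
    4 * (n * n * n)                                        ≡⟨ e₁ n ⟩
    n * ((n * 2) * (n * 2))                                ≤⟨ *-monoʳ-≤ n S-lower ⟩
    n * (K * (S + S + n * 2))                              ≡⟨ e₂ n K S ⟩
    -- The second `K` is weakened to `K * K`, so that its `2 * (n * n)` joins the `10 * (n * n)`
    -- coming from `S-upper`.
    K * (2 * (n * S)) + K * (2 * (n * n))                  ≤⟨ +-mono-≤ (*-monoʳ-≤ K (*-monoʳ-≤ 2 (S-upper minimal))) (*-monoˡ-≤ (2 * (n * n)) (m≤m*n K K)) ⟩
    K * (2 * (K * (3 * T + n * (5 * n)))) + K * K * (2 * (n * n))  ≡⟨ e₃ n K T ⟩
    K * K * (6 * T + 12 * (n * n))                         ∎
    where
    open ≤-Reasoning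
    T = badCount φ
    e₁ : ∀ n → 4 * (n * n * n) ≡ n * ((n * 2) * (n * 2))
    e₁ = solve-∀
    e₂ : ∀ n K S → n * (K * (S + S + n * 2)) ≡ K * (2 * (n * S)) + K * (2 * (n * n))
    e₂ = solve-∀
    e₃ : ∀ n K T → K * (2 * (K * (3 * T + n * (5 * n)))) + K * K * (2 * (n * n)) ≡ K * K * (6 * T + 12 * (n * n))
    e₃ = solve-∀

-- From the cubic inequality to the asymptotic statement

open ℤ using (+_)

2*[1+n]C2 : ∀ n → 2 * (suc n C 2) ≡ suc n * n
2*[1+n]C2 zero    = refl
2*[1+n]C2 (suc n) = begin
  2 * (suc (suc n) C 2)              ≡⟨ cong (2 *_) (nCk+nC[k+1]≡[n+1]C[k+1] (suc n) 1) ⟨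
  2 * (suc n C 1 + suc n C 2)        ≡⟨ *-distribˡ-+ 2 (suc n C 1) (suc n C 2) ⟩
  2 * (suc n C 1) + 2 * (suc n C 2)  ≡⟨ cong₂ _+_ (cong (2 *_) (nC1≡n (suc n))) (2*[1+n]C2 n) ⟩
  2 * suc n + suc n * n              ≡⟨ collect n ⟩
  suc (suc n) * suc n                ∎
  where
  open ≡-Reasoning
  collect : ∀ n → 2 * suc n + suc n * n ≡ suc (suc n) * suc n
  collect = solve-∀

-- Induction by Pascal's rule; the shift by 2 avoids truncated subtraction in the falling product.
6*[2+n]C3 : ∀ n → 6 * (suc (suc n) C 3) ≡ suc (suc n) * suc n * n
6*[2+n]C3 zero    = refl
6*[2+n]C3 (suc n) = begin
  6 * (suc N C 3)                    ≡⟨ cong (6 *_) (nCk+nC[k+1]≡[n+1]C[k+1] N 2) ⟨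
  6 * (N C 2 + N C 3)                ≡⟨ split (N C 2) (N C 3) ⟩
  3 * (2 * (N C 2)) + 6 * (N C 3)    ≡⟨ cong₂ (λ s t → 3 * s + t) (2*[1+n]C2 (suc n)) (6*[2+n]C3 n) ⟩
  3 * (N * suc n) + N * suc n * n    ≡⟨ collect n ⟩
  suc N * N * suc n                  ∎
  where
  open ≡-Reasoning
  N = suc (suc n)
  split : ∀ s t → 6 * (s + t) ≡ 3 * (2 * s) + 6 * t
  split = solve-∀
  collect : ∀ n → 3 * (suc (suc n) * suc n) + suc (suc n) * suc n * n ≡ suc (suc (suc n)) * suc (suc n) * suc n
  collect = solve-∀

-- The conclusion is (1 - 18 K² / (n + 1)) · 4 / K² · (n C 3) ≤ T with denominators cleared.
ratio-bound : ∀ K T n → 4 * (n * n * n) ≤ K * K * (6 * T + 12 * (n * n)) →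
  4 * (n C 3) * suc n ≤ T * (K * K) * suc n + 18 * (K * K) * 4 * (n C 3)
-- Below 3 vertices the binomial coefficient is 0 and so is the left-hand side.
ratio-bound K T 0 _ = z≤n
ratio-bound K T 1 _ = z≤n
ratio-bound K T 2 _ = z≤n
ratio-bound K T n@(suc (suc (suc j))) bound = begin
  4 * b * suc n
    ≤⟨ *-monoˡ-≤ (suc n) 4b≤ ⟩
  K * K * (T + 2 * (n * n)) * suc n
    ≡⟨ expand (K * K) T (n * n) (suc n) ⟩
  T * (K * K) * suc n + K * K * 2 * (n * n * suc n)
    ≤⟨ +-monoʳ-≤ (T * (K * K) * suc n) (*-monoʳ-≤ (K * K * 2) n³≤36b) ⟩
  T * (K * K) * suc n + K * K * 2 * (36 * b)
    ≡⟨ cong (λ s → T * (K * K) * suc n + s) (regroup (K * K) b) ⟩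
  T * (K * K) * suc n + 18 * (K * K) * 4 * b ∎
  where
  open ≤-Reasoning
  b = n C 3
  6b≡ : 6 * b ≡ n * suc (suc j) * suc j
  6b≡ = 6*[2+n]C3 (suc j)
  expand : ∀ k t q s → k * (t + 2 * q) * s ≡ t * k * s + k * 2 * (q * s)
  expand = solve-∀
  regroup : ∀ k b → k * 2 * (36 * b) ≡ 18 * k * 4 * b
  regroup = solve-∀
  6b≤n³ : 6 * b ≤ n * n * n
  6b≤n³ = ≤-trans (≤-reflexive 6b≡) (*-mono-≤ {n * suc (suc j)} {n * n} {suc j} {n} (*-monoʳ-≤ n (n≤1+n (suc (suc j)))) (m≤n+m (suc j) 2))
  4b≤ : 4 * b ≤ K * K * (T + 2 * (n * n))
  4b≤ = *-cancelˡ-≤ 6 (begin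
    6 * (4 * b)                          ≡⟨ swap b ⟩
    4 * (6 * b)                          ≤⟨ *-monoʳ-≤ 4 6b≤n³ ⟩
    4 * (n * n * n)                      ≤⟨ bound ⟩
    K * K * (6 * T + 12 * (n * n))       ≡⟨ factor (K * K) T (n * n) ⟩
    6 * (K * K * (T + 2 * (n * n)))      ∎)
    where
    swap : ∀ b → 6 * (4 * b) ≡ 4 * (6 * b)
    swap = solve-∀
    factor : ∀ k t q → k * (6 * t + 12 * q) ≡ 6 * (k * (t + 2 * q))
    factor = solve-∀
  -- Equality at `n = 3` forces the constant 36, and `2 * 36 = 18 * 4` yields the 18 in the error
  -- term.
  n³≤36b : n * n * suc n ≤ 36 * b
  n³≤36b = begin
    n * n * suc n                                 ≤⟨ m≤m+n _ (n * (11 * j + 5 * (j * j))) ⟩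
    n * n * suc n + n * (11 * j + 5 * (j * j))    ≡⟨ slack j ⟩
    6 * (n * suc (suc j) * suc j)                 ≡⟨ cong (6 *_) 6b≡ ⟨
    6 * (6 * b)                                   ≡⟨ *-assoc 6 6 b ⟨
    36 * b                                        ∎
    where
    slack : ∀ j → (3 + j) * (3 + j) * (4 + j) + (3 + j) * (11 * j + 5 * (j * j)) ≡ 6 * ((3 + j) * (2 + j) * (1 + j))
    slack = solve-∀

-- Unnormalised rationals keep the literal numerators and denominators, so there the claim becomes
-- an integer inequality. The hypothesis has the negative term moved to the right and can be stated
-- in `ℕ`.
clear-denominators : ∀ c n d b t → 4 * b * suc n ≤ t * suc d * suc n + c * 4 * b →
  (1ℚ - + c / suc n) ℚ.* (+ 4 / suc d) ℚ.* (+ b / 1) ℚ.≤ + t / 1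
clear-denominators c n d b t bound = ℚₚ.toℚᵘ-cancel-≤ (begin
  toℚᵘ ((1ℚ - + c / suc n) ℚ.* (+ 4 / suc d) ℚ.* (+ b / 1))
    ≃⟨ ℚₚ.toℚᵘ-homo-* ((1ℚ - + c / suc n) ℚ.* (+ 4 / suc d)) (+ b / 1) ⟩
  toℚᵘ ((1ℚ - + c / suc n) ℚ.* (+ 4 / suc d)) ℚᵘ.* toℚᵘ (+ b / 1)
    ≃⟨ ℚᵘₚ.*-cong (ℚₚ.toℚᵘ-homo-* (1ℚ - + c / suc n) (+ 4 / suc d)) (ℚₚ.toℚᵘ-fromℚᵘ (mkℚᵘ (+ b) 0)) ⟩
  toℚᵘ (1ℚ - + c / suc n) ℚᵘ.* toℚᵘ (+ 4 / suc d) ℚᵘ.* mkℚᵘ (+ b) 0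
    ≃⟨ ℚᵘₚ.*-congʳ (ℚᵘₚ.*-cong difference (ℚₚ.toℚᵘ-fromℚᵘ (mkℚᵘ (+ 4) d))) ⟩
  (mkℚᵘ (+ 1) 0 ℚᵘ.- mkℚᵘ (+ c) n) ℚᵘ.* mkℚᵘ (+ 4) d ℚᵘ.* mkℚᵘ (+ b) 0
    ≤⟨ *≤* integers ⟩
  mkℚᵘ (+ t) 0
    ≃⟨ ℚₚ.toℚᵘ-fromℚᵘ (mkℚᵘ (+ t) 0) ⟨
  toℚᵘ (+ t / 1) ∎)
  where
  open ℚᵘₚ.≤-Reasoning
  difference : toℚᵘ (1ℚ - + c / suc n) ℚᵘ.≃ mkℚᵘ (+ 1) 0 ℚᵘ.- mkℚᵘ (+ c) n
  difference = ℚᵘₚ.≃-trans (ℚₚ.toℚᵘ-homo-+ 1ℚ (ℚ.- (+ c / suc n))) (ℚᵘₚ.+-congʳ (mkℚᵘ (+ 1) 0)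
    (ℚᵘₚ.≃-trans (ℚₚ.toℚᵘ-homo‿- (+ c / suc n)) (ℚᵘₚ.-‿cong (ℚₚ.toℚᵘ-fromℚᵘ (mkℚᵘ (+ c) n)))))
  product₃ : ∀ x y z → + (x * y * z) ≡ + x ℤ.* + y ℤ.* + z
  product₃ x y z = trans (ℤₚ.pos-* (x * y) z) (cong (ℤ._* + z) (ℤₚ.pos-* x y))
  integer-bound : + 4 ℤ.* + b ℤ.* + suc n ℤ.≤ + t ℤ.* + suc d ℤ.* + suc n ℤ.+ + c ℤ.* + 4 ℤ.* + b
  integer-bound = subst₂ ℤ._≤_ (product₃ 4 b (suc n))
    (cong₂ ℤ._+_ (product₃ t (suc d) (suc n)) (product₃ c 4 b)) (ℤ.+≤+ bound)
  integers : (+ 1 ℤ.* + suc n ℤ.+ ℤ.- + c ℤ.* + 1) ℤ.* + 4 ℤ.* + b ℤ.* + 1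
             ℤ.≤ + t ℤ.* + (1 * suc n * suc d * 1)
  integers = subst₂ ℤ._≤_ (left (+ b) (+ c) (+ suc n))
    (trans (right (+ t) (+ b) (+ c) (+ suc n) (+ suc d)) (cong (+ t ℤ.*_) (sym denominator)))
    (ℤₚ.+-monoˡ-≤ (ℤ.- (+ c ℤ.* + 4 ℤ.* + b)) integer-bound)
    where
    denominator : + (1 * suc n * suc d * 1) ≡ + suc n ℤ.* + suc d
    denominator = trans (cong +_ (trans (*-identityʳ _) (cong (_* suc d) (*-identityˡ (suc n))))) (ℤₚ.pos-* (suc n) (suc d))
    left : ∀ b c n → + 4 ℤ.* b ℤ.* n ℤ.+ ℤ.- (c ℤ.* + 4 ℤ.* b) ≡ (+ 1 ℤ.* n ℤ.+ ℤ.- c ℤ.* + 1) ℤ.* + 4 ℤ.* b ℤ.* + 1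
    left = solveℤ-∀
    right : ∀ t b c n d → t ℤ.* d ℤ.* n ℤ.+ c ℤ.* + 4 ℤ.* b ℤ.+ ℤ.- (c ℤ.* + 4 ℤ.* b) ≡ t ℤ.* (n ℤ.* d)
    right = solveℤ-∀

c/[1+n]-tendsToZero : ∀ c → TendsToZero (λ n → + c / suc n)
c/[1+n]-tendsToZero c (mkℚ (+ zero)     q _) (ℚ.*<* (ℤ.+<+ ()))
c/[1+n]-tendsToZero c (mkℚ ℤ.-[1+ _ ]   q _) (ℚ.*<* ())
-- With `ε` equal to `suc p / suc q`, the witness gives `c * suc q < suc n ≤ suc p * suc n`, which
-- is the required inequality cross-multiplied.
c/[1+n]-tendsToZero c ε@(mkℚ (+ suc p) q _) _ = c * suc q , below
  where
  below : ∀ n → c * suc q ≤ n → ℚ.∣ + c / suc n ∣ ℚ.< ε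
  below n N≤n = subst (ℚ._< ε) (sym (ℚₚ.0≤p⇒∣p∣≡p (ℚₚ.nonNegative⁻¹ (+ c / suc n) {{ℚₚ.normalize-nonNeg c (suc n)}})))
    (ℚₚ.toℚᵘ-cancel-< (begin-strict
      toℚᵘ (+ c / suc n)  ≃⟨ ℚₚ.toℚᵘ-fromℚᵘ (mkℚᵘ (+ c) n) ⟩
      mkℚᵘ (+ c) n        <⟨ *<* (subst₂ ℤ._<_ (ℤₚ.pos-* c (suc q)) (ℤₚ.pos-* (suc p) (suc n)) (ℤ.+<+ (≤-trans (s≤s N≤n) (m≤n*m (suc n) (suc p))))) ⟩
      toℚᵘ ε              ∎))
    where open ℚᵘₚ.≤-Reasoning

theorem4p11 : (k : ℕ) → k % 2 ≡ 1 →
    ∃[ o ] (TendsToZero o ×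
      ((n : ℕ) (φ : Labeling k n) → MinimizesBad φ →
        (1ℚ - o n) ℚ.* (+ 4 / (suc k ^ 2)) ℚ.* fromℕ (n C 3) ℚ.≤ fromℕ (badCount φ)))
-- Oddness excludes `k = 0`, so the label set has the form `Fin (suc k′)`.
theorem4p11 k@(suc k′) _ = (λ n → + (18 * (K * K)) / suc n) , c/[1+n]-tendsToZero (18 * (K * K)) , bound
  where
  K = suc k
  cubic : ∀ n (φ : Labeling k n) → MinimizesBad φ → 4 * (n * n * n) ≤ K * K * (6 * badCount φ + 12 * (n * n))
  cubic zero    φ _       = z≤n
  cubic (suc m) φ minimal = Areas.badCount-lower φ (proj₁ minimal) minimal
  bound : ∀ n (φ : Labeling k n) → MinimizesBad φ →
    (1ℚ - + (18 * (K * K)) / suc n) ℚ.* (+ 4 / (suc k ^ 2)) ℚ.* fromℕ (n C 3) ℚ.≤ fromℕ (badCount φ)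
  bound n φ minimal = clear-denominators (18 * (K * K)) n _ (n C 3) (badCount φ)
    -- The denominator `suc k ^ 2` unfolds to `K * (K * 1)`, which has to be matched with `K * K`.
    (subst (λ d → 4 * (n C 3) * suc n ≤ badCount φ * d * suc n + 18 * (K * K) * 4 * (n C 3))
      (cong (K *_) (sym (*-identityʳ K))) (ratio-bound K (badCount φ) n (cubic n φ minimal)))
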